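{- There does not exist a function $f_3:\mathbb{N}\to\mathbb{N}$ with $f_3(n)\to\infty$ as $n\to\infty$ such that, for every $n$, every $n$-vertex $4$-critical graph contains cycles whose lengths are $f_3(n)$ consecutive integers.
   Context: All graphs are finite and simple. The length of a cycle is its number of edges. A graph $G$ is $k$-critical if $\chi(G)=k$ and every proper subgraph of $G$ is $(k-1)$-colorable. A graph "contains cycles whose lengths are $m$ consecutive integers" if there is an integer $a$ such that the graph contains a cycle of length $\ell$ for each $\ell\in\{a,a+1,\ldots,a+m-1\}$. -}

module Defs where

open import Data.Bool.Base using (Bool; T)
open import Data.Fin.Base using (Fin; toℕ)
open import Data.Nat.Base using (ℕ; suc; _+_; _∸_; _≤_; _<_)
open import Data.Product.Base using (Σ; _×_; proj₁; Σ-syntax; ∃-syntax)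
open import Function.Definitions using (Injective)
open import Relation.Binary.Core using (Rel)
open import Relation.Binary.Definitions using (Symmetric; Irreflexive)
open import Relation.Binary.PropositionalEquality.Core using (_≡_; _≢_; cong)
open import Relation.Nullary.Negation.Core using (¬_)
open import Level using (0ℓ)

-- Simple graphs on the vertex type V.  Adjacency is Boolean-valued, so that
-- edge sets are honest (decidable) subsets; an n-vertex graph is a Graph (Fin n).
record Graph (V : Set) : Set where
  field
    adj : V → V → Bool

  Adj : Rel V 0ℓ
  Adj u v = T (adj u v)

  field
    symmetric   : Symmetric Adj
    irreflexive : Irreflexive _≡_ Adj

open Graph public using (Adj)

-- A subgraph may drop vertices as well as edges.
record Subgraph {V : Set} (G : Graph V) : Set where
  field
    vertex : V → Bool
    edge   : V → V → Bool

  Vertex : V → Set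
  Vertex v = T (vertex v)

  Edge : Rel V 0ℓ
  Edge u v = T (edge u v)

  field
    edge-symmetric : Symmetric Edge
    edge⊆          : ∀ {u v} → Edge u v → Adj G u v
    endpoint       : ∀ {u v} → Edge u v → Vertex u

  -- T b has at most one element, so this Σ-type has exactly one element for
  -- each vertex of the subgraph.
  toGraph : Graph (Σ V Vertex)
  toGraph = record
    { adj         = λ u v → edge (proj₁ u) (proj₁ v)
    ; symmetric   = edge-symmetric
    ; irreflexive = λ u≡v e → Graph.irreflexive G (cong proj₁ u≡v) (edge⊆ e)
    }

  Proper : Set
  Proper = ¬ ((∀ v → Vertex v) × (∀ u v → Adj G u v → Edge u v))

open Subgraph public using (toGraph; Proper)

Colorable : {V : Set} → Graph V → ℕ → Set
Colorable {V} G k = Σ[ c ∈ (V → Fin k) ] (∀ u v → Adj G u v → c u ≢ c v)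

-- χ(G) = k
HasChromaticNumber : {V : Set} → Graph V → ℕ → Set
HasChromaticNumber G k = Colorable G k × (∀ j → Colorable G j → k ≤ j)

-- Only meaningful for k ≥ 1, because of the truncated subtraction.
Critical : {V : Set} → ℕ → Graph V → Set
Critical k G =
  HasChromaticNumber G k ×
  (∀ (H : Subgraph G) → Proper H → Colorable (toGraph H) (k ∸ 1))

-- A cycle with ℓ edges, presented by its ℓ distinct vertices in cyclic order.
record Cycle {V : Set} (G : Graph V) (ℓ : ℕ) : Set where
  field
    3≤ℓ       : 3 ≤ ℓ
    at        : Fin ℓ → V
    injective : Injective _≡_ _≡_ at
    step      : ∀ i j → toℕ j ≡ suc (toℕ i) → Adj G (at i) (at j)
    close     : ∀ i j → suc (toℕ i) ≡ ℓ → toℕ j ≡ 0 → Adj G (at i) (at j)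

-- Cycle lengths are at least 3, so taking the initial length a in ℕ rather
-- than ℤ loses nothing.
ContainsConsecutiveCycles : {V : Set} → Graph V → ℕ → Set
ContainsConsecutiveCycles G m =
  ∃[ a ] (∀ ℓ → a ≤ ℓ → ℓ < a + m → Cycle G ℓ)

TendsToInfinity : (ℕ → ℕ) → Set
TendsToInfinity f = ∀ M → ∃[ N ] (∀ n → N ≤ n → M ≤ f n)

{-# OPTIONS --safe #-}
module Submission where

open import Defs
open import Data.Bool.Base using (Bool; true; false; not; T; _∨_)
open import Data.Bool.Properties using (T-∨; T?; not-involutive)
open import Data.Empty using (⊥-elim)
open import Data.Fin.Base using (Fin; zero; suc; toℕ; fromℕ; inject₁; inject≤)
open import Data.Fin.Properties using (_≟_; all?; any?; ¬∀⟶∃¬; toℕ-injective; toℕ-fromℕ<;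
  fromℕ≢inject₁; inject₁-injective; inject≤-injective)
open import Data.Nat.Base using (ℕ; zero; suc; _+_; _*_; _≤_; _<_; z≤n; s≤s; NonZero)
open import Data.Nat.DivMod using (m/n*n≤m; _%_; _/_; _mod_; m%n<n; n%n≡0; m≡m%n+[m/n]*n;
  [m+n]%n≡m%n; [m+kn]%n≡m%n; m<n⇒m%n≡m)
open import Data.Nat.Properties using (≤-refl; ≤-trans; <⇒≤; <⇒≱; ≰⇒>; n≤1+n; m≤n⇒m≤1+n;
  m<1+n⇒m≤n; m≤n⇒m<n∨m≡n; m≤n+m; +-assoc; +-comm; +-identityʳ; +-monoˡ-<; +-cancelˡ-<;
  *-cancelʳ-<; *-cancelʳ-≡; suc-injective; 1+n≢n; m≤m+n; +-mono-≤; +-monoˡ-≤; ≤-reflexive;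
  anyUpTo?)
open import Data.Product.Base using (_×_; _,_; proj₁; proj₂; Σ-syntax; ∃-syntax)
open import Data.Sum.Base using (_⊎_; inj₁; inj₂)
open import Data.Unit.Base using (tt)
open import Function.Base using (_∘_)
open import Function.Bundles using (Equivalence)
open import Relation.Binary.PropositionalEquality using (_≡_; _≢_; refl; sym; trans; cong;
  subst; subst₂)
open import Relation.Nullary.Decidable using (Dec; yes; no; ⌊_⌋; decidable-stable;
  toWitness; fromWitness; ¬?; _×-dec_; _→-dec_)
open import Relation.Nullary.Negation.Core using (¬_)

-- Iterate the Hajós construction on copies of K₄.  The gadget H₀ is a single
-- vertex, serving as both of its ends; H_{k+1} adds to H_k the vertices left,
-- right, mid, the edges from left and right to mid and to the first end of H_k,
-- and the edge from mid to the second end; its ends are left and right.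
-- Every 3-colouring of H_k gives both ends the same colour, but after deleting
-- any edge some 3-colouring separates them, so that chain k, which is H_{k+1}
-- plus the edge joining its ends, is 4-critical.  A path joining the ends of
-- H_{k+1} either has length 2 or is a path joining the ends of H_k with 3 edges
-- added, and a cycle of H_{k+1} not inside H_k either has length 4 or is such a
-- path of H_k with 3 edges added.  Hence path lengths between the ends of H_k are
-- 3k or 2 mod 3, and the only cycle lengths of chain k that are 1 mod 3 are 4
-- and 3(k+1) + 1.

-- The gadgets and the chain graphs.

size : ℕ → ℕ
size zero    = 1
size (suc k) = 3 + size k

pattern left  = zero
pattern right = suc zero
pattern mid   = suc (suc zero)
pattern low v = suc (suc (suc v))

end : ∀ k → Bool → Fin (size k)
end zero    _     = zero
end (suc k) true  = left
end (suc k) false = right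

isEnd : ∀ k → Bool → Fin (size k) → Bool
isEnd k s v = ⌊ v ≟ end k s ⌋

gadgetAdj : ∀ k → Fin (size k) → Fin (size k) → Bool
gadgetAdj zero    _       _       = false
gadgetAdj (suc k) left    left    = false
gadgetAdj (suc k) left    right   = false
gadgetAdj (suc k) left    mid     = true
gadgetAdj (suc k) left    (low v) = isEnd k true v
gadgetAdj (suc k) right   left    = false
gadgetAdj (suc k) right   right   = false
gadgetAdj (suc k) right   mid     = true
gadgetAdj (suc k) right   (low v) = isEnd k true v
gadgetAdj (suc k) mid     left    = true
gadgetAdj (suc k) mid     right   = true
gadgetAdj (suc k) mid     mid     = false
gadgetAdj (suc k) mid     (low v) = isEnd k false v
gadgetAdj (suc k) (low u) left    = isEnd k true u
gadgetAdj (suc k) (low u) right   = isEnd k true u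
gadgetAdj (suc k) (low u) mid     = isEnd k false u
gadgetAdj (suc k) (low u) (low v) = gadgetAdj k u v

Gadget : ∀ k → Fin (size k) → Fin (size k) → Set
Gadget k u v = T (gadgetAdj k u v)

isEnd⇒≡ : ∀ k s {v} → T (isEnd k s v) → v ≡ end k s
isEnd⇒≡ k s {v} = toWitness {a? = v ≟ end k s}

≡⇒isEnd : ∀ k s → T (isEnd k s (end k s))
≡⇒isEnd k s = fromWitness {a? = end k s ≟ end k s} refl

Gadget-sym : ∀ k u v → Gadget k u v → Gadget k v u
Gadget-sym (suc k) left    mid     e = e
Gadget-sym (suc k) left    (low v) e = e
Gadget-sym (suc k) right   mid     e = e
Gadget-sym (suc k) right   (low v) e = e
Gadget-sym (suc k) mid     left    e = e
Gadget-sym (suc k) mid     right   e = e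
Gadget-sym (suc k) mid     (low v) e = e
Gadget-sym (suc k) (low u) left    e = e
Gadget-sym (suc k) (low u) right   e = e
Gadget-sym (suc k) (low u) mid     e = e
Gadget-sym (suc k) (low u) (low v) e = Gadget-sym k u v e

Gadget-irrefl : ∀ k u → ¬ Gadget k u u
Gadget-irrefl (suc k) left    ()
Gadget-irrefl (suc k) right   ()
Gadget-irrefl (suc k) mid     ()
Gadget-irrefl (suc k) (low u) e = Gadget-irrefl k u e

closingAdj : ∀ {n} → Fin (3 + n) → Fin (3 + n) → Bool
closingAdj left  right = true
closingAdj right left  = true
closingAdj _     _     = false

chainAdj : ∀ k → Fin (size (suc k)) → Fin (size (suc k)) → Bool
chainAdj k u v = gadgetAdj (suc k) u v ∨ closingAdj u v

-- A view of `chainAdj` on which proofs can split; the Boolean disjunction itself would not reduce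
-- on variable vertices.
data ChainEdge k : Fin (size (suc k)) → Fin (size (suc k)) → Set where
  inner    : ∀ {u v} → Gadget (suc k) u v → ChainEdge k u v
  closing  : ChainEdge k left right
  closing˘ : ChainEdge k right left

chainEdge : ∀ k u v → T (chainAdj k u v) → ChainEdge k u v
chainEdge k u v e with Equivalence.to (T-∨ {gadgetAdj (suc k) u v} {closingAdj u v}) e
chainEdge k u     v     e | inj₁ i = inner i
chainEdge k left  right e | inj₂ _ = closing
chainEdge k right left  e | inj₂ _ = closing˘

fromChainEdge : ∀ k u v → ChainEdge k u v → T (chainAdj k u v)
fromChainEdge k u v (inner i) =
  Equivalence.from (T-∨ {gadgetAdj (suc k) u v} {closingAdj u v}) (inj₁ i)
fromChainEdge k _ _ closing  = tt
fromChainEdge k _ _ closing˘ = tt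

chain : ∀ k → Graph (Fin (size (suc k)))
chain k = record
  { adj         = chainAdj k
  ; symmetric   = λ {u} {v} e → fromChainEdge k v u (swap (chainEdge k u v e))
  ; irreflexive = λ { {u} refl e → distinct (chainEdge k u u e) refl }
  }
  where
  swap : ∀ {u v} → ChainEdge k u v → ChainEdge k v u
  swap (inner {u} {v} e) = inner (Gadget-sym (suc k) u v e)
  swap closing           = closing˘
  swap closing˘          = closing

  distinct : ∀ {u v} → ChainEdge k u v → u ≢ v
  distinct (inner {u} e)   refl = Gadget-irrefl (suc k) u e
  distinct closing  ()
  distinct closing˘ ()

-- Colourings

third-colour : ∀ (α β : Fin 3) → ∃[ γ ] (γ ≢ α × γ ≢ β)
third-colour = toWitness {a? = all? λ α → all? λ β → any? λ γ → ¬? (γ ≟ α) ×-dec ¬? (γ ≟ β)} tt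

third-colour-unique : ∀ (α β γ δ : Fin 3) → β ≢ α → γ ≢ α → γ ≢ β → δ ≢ α → δ ≢ β → γ ≡ δ
third-colour-unique = toWitness {a? = all? λ α → all? λ β → all? λ γ → all? λ δ →
  ¬? (β ≟ α) →-dec ¬? (γ ≟ α) →-dec ¬? (γ ≟ β) →-dec ¬? (δ ≟ α) →-dec ¬? (δ ≟ β) →-dec γ ≟ δ} tt

ProperFor : {V C : Set} → (V → V → Set) → (V → C) → Set
ProperFor R c = ∀ u v → R u v → c u ≢ c v

-- By induction the inner ends share a colour, and `mid` differs from it because it sees the second
-- inner end. Both `left` and `right` avoid that colour and the colour of `mid`, so only one of
-- three colours remains for them.
ends-agree : ∀ k (c : Fin (size k) → Fin 3) → ProperFor (Gadget k) c →
             c (end k true) ≡ c (end k false)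
ends-agree zero    c proper = refl
ends-agree (suc k) c proper = third-colour-unique (c (low (end k true))) (c mid) (c left) (c right)
  (λ e → proper mid (low (end k false)) (≡⇒isEnd k false) (trans e agree))
  (proper left (low (end k true)) (≡⇒isEnd k true))
  (proper left mid tt)
  (proper right (low (end k true)) (≡⇒isEnd k true))
  (proper right mid tt)
  where
  agree : c (low (end k true)) ≡ c (low (end k false))
  agree = ends-agree k (c ∘ low) (λ u v → proper (low u) (low v))

extend : ∀ {n} {C : Set} → (Fin n → C) → C → C → C → Fin (3 + n) → C
extend c l r m left    = l
extend c l r m right   = r
extend c l r m mid     = m
extend c l r m (low v) = c v

module _ {k} (R : Fin (size (suc k)) → Fin (size (suc k)) → Set)
         (R-sym : ∀ u v → R u v → R v u) (R⊆ : ∀ u v → R u v → Gadget (suc k) u v) where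

  -- Each inequality is demanded only when `R` has the edge in question, so the same lemma serves
  -- the whole gadget and the gadget with edges deleted.
  extend-proper : ∀ {C : Set} (c : Fin (size k) → C) {l r m α β} →
    ProperFor (λ u v → R (low u) (low v)) c →
    c (end k true) ≡ α → c (end k false) ≡ β →
    (R left  (low (end k true))  → l ≢ α) →
    (R right (low (end k true))  → r ≢ α) →
    (R mid   (low (end k false)) → m ≢ β) →
    (R left  mid → l ≢ m) →
    (R right mid → r ≢ m) →
    ProperFor R (extend c l r m)
  extend-proper c {l} {r} {m} proper refl refl la ra mb lm rm = go
    where
    left-low : ∀ v → R left (low v) → l ≢ c v
    left-low v e with isEnd⇒≡ k true {v} (R⊆ _ _ e)
    ... | refl = la e
    right-low : ∀ v → R right (low v) → r ≢ c v
    right-low v e with isEnd⇒≡ k true {v} (R⊆ _ _ e)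
    ... | refl = ra e
    mid-low : ∀ v → R mid (low v) → m ≢ c v
    mid-low v e with isEnd⇒≡ k false {v} (R⊆ _ _ e)
    ... | refl = mb e
    go : ProperFor R (extend c l r m)
    go left    left    e = ⊥-elim (R⊆ _ _ e)
    go left    right   e = ⊥-elim (R⊆ _ _ e)
    go left    mid     e = lm e
    go left    (low v) e = left-low v e
    go right   left    e = ⊥-elim (R⊆ _ _ e)
    go right   right   e = ⊥-elim (R⊆ _ _ e)
    go right   mid     e = rm e
    go right   (low v) e = right-low v e
    go mid     left    e = lm (R-sym _ _ e) ∘ sym
    go mid     right   e = rm (R-sym _ _ e) ∘ sym
    go mid     mid     e = ⊥-elim (R⊆ _ _ e)
    go mid     (low v) e = mid-low v e
    go (low u) left    e = left-low u (R-sym _ _ e) ∘ sym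
    go (low u) right   e = right-low u (R-sym _ _ e) ∘ sym
    go (low u) mid     e = mid-low u (R-sym _ _ e) ∘ sym
    go (low u) (low v) e = proper u v e

-- The colour of the ends is prescribed so that the induction can give the inner ends a colour
-- different from that of the new ones.
gadget-colouring : ∀ k α → Σ[ c ∈ (Fin (size k) → Fin 3) ]
  (ProperFor (Gadget k) c × (∀ s → c (end k s) ≡ α))
gadget-colouring zero    α = (λ _ → α) , (λ u v ()) , λ s → refl
gadget-colouring (suc k) α =
  -- Repeating `α` asks merely for some colour other than `α`.
  let β , β≢α , _   = third-colour α α
      γ , γ≢α , γ≢β = third-colour α β
      c , proper , c≡β = gadget-colouring k β
  in extend c α α γ ,
     extend-proper (Gadget (suc k)) (Gadget-sym (suc k)) (λ u v e → e) c proper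
       (c≡β true) (c≡β false)
       (λ _ → β≢α ∘ sym) (λ _ → β≢α ∘ sym) (λ _ → γ≢β) (λ _ → γ≢α ∘ sym) (λ _ → γ≢α ∘ sym) ,
     λ { true → refl ; false → refl }

Separable : ∀ k → (Fin (size k) → Fin (size k) → Set) → Set
Separable k R = Σ[ c ∈ (Fin (size k) → Fin 3) ]
  (ProperFor R c × c (end k true) ≢ c (end k false))

-- If one of the five kinds of top edge is missing, the lower gadget keeps a colouring with equal
-- ends and the lost constraint gives the freedom needed. Otherwise the missing edge lies lower and
-- the separation is passed upwards. `H₀` has no edge to miss, hence no case for `zero`.
separate : ∀ k (R : Fin (size k) → Fin (size k) → Set) →
  (∀ u v → R u v → R v u) → (∀ u v → R u v → Gadget k u v) →
  ∀ u v → Gadget k u v → ¬ R u v → Separable k R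
separate (suc k) R R-sym R⊆ = go
  where
  c₀ : Fin (size k) → Fin 3
  c₀ = proj₁ (gadget-colouring k zero)

  -- The constant `zero` is the colour that `c₀` gives to both inner ends.
  top : ∀ l r m → l ≢ r →
    (R left  (low (end k true))  → l ≢ zero) →
    (R right (low (end k true))  → r ≢ zero) →
    (R mid   (low (end k false)) → m ≢ zero) →
    (R left  mid → l ≢ m) →
    (R right mid → r ≢ m) → Separable (suc k) R
  top l r m l≢r la ra mb lm rm =
    extend c₀ l r m ,
    extend-proper R R-sym R⊆ c₀
      (λ u v e → proj₁ (proj₂ (gadget-colouring k zero)) u v (R⊆ _ _ e))
      (proj₂ (proj₂ (gadget-colouring k zero)) true)
      (proj₂ (proj₂ (gadget-colouring k zero)) false)
      la ra mb lm rm ,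
    l≢r

  without-left-low : ∀ v → Gadget (suc k) left (low v) → ¬ R left (low v) → Separable (suc k) R
  without-left-low v e ¬e with isEnd⇒≡ k true {v} e
  ... | refl =
    top zero (suc (suc zero)) (suc zero) (λ ()) (⊥-elim ∘ ¬e) (λ _ ()) (λ _ ()) (λ _ ()) (λ _ ())

  without-right-low : ∀ v → Gadget (suc k) right (low v) → ¬ R right (low v) → Separable (suc k) R
  without-right-low v e ¬e with isEnd⇒≡ k true {v} e
  ... | refl =
    top (suc (suc zero)) zero (suc zero) (λ ()) (λ _ ()) (⊥-elim ∘ ¬e) (λ _ ()) (λ _ ()) (λ _ ())

  without-mid-low : ∀ v → Gadget (suc k) mid (low v) → ¬ R mid (low v) → Separable (suc k) R
  without-mid-low v e ¬e with isEnd⇒≡ k false {v} e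
  ... | refl =
    top (suc zero) (suc (suc zero)) zero (λ ()) (λ _ ()) (λ _ ()) (⊥-elim ∘ ¬e) (λ _ ()) (λ _ ())

  without-left-mid : ¬ R left mid → Separable (suc k) R
  without-left-mid ¬e =
    top (suc zero) (suc (suc zero)) (suc zero) (λ ()) (λ _ ()) (λ _ ()) (λ _ ()) (⊥-elim ∘ ¬e) (λ _ ())

  without-right-mid : ¬ R right mid → Separable (suc k) R
  without-right-mid ¬e =
    top (suc (suc zero)) (suc zero) (suc zero) (λ ()) (λ _ ()) (λ _ ()) (λ _ ()) (λ _ ()) (⊥-elim ∘ ¬e)

  -- The inner ends now have colours `α` and `β`. Since `mid` sees only the second of them, it may
  -- reuse `α`; then `left` and `right` need only avoid `α`, and they take `β` and the third colour.
  without-low-low : ∀ u v → Gadget k u v → ¬ R (low u) (low v) → Separable (suc k) R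
  without-low-low u v e ¬e =
    let c , proper , α≢β = separate k (λ u v → R (low u) (low v))
                             (λ u v → R-sym (low u) (low v)) (λ u v → R⊆ (low u) (low v)) u v e ¬e
        γ , γ≢α , γ≢β = third-colour (c (end k true)) (c (end k false))
    in extend c (c (end k false)) γ (c (end k true)) ,
       extend-proper R R-sym R⊆ c proper refl refl
         (λ _ → α≢β ∘ sym) (λ _ → γ≢α) (λ _ → α≢β) (λ _ → α≢β ∘ sym) (λ _ → γ≢α) ,
       γ≢β ∘ sym

  go : ∀ u v → Gadget (suc k) u v → ¬ R u v → Separable (suc k) R
  go left    mid     e ¬e = without-left-mid ¬e
  go left    (low v) e ¬e = without-left-low v e ¬e
  go right   mid     e ¬e = without-right-mid ¬e
  go right   (low v) e ¬e = without-right-low v e ¬e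
  go mid     left    e ¬e = without-left-mid (¬e ∘ R-sym _ _)
  go mid     right   e ¬e = without-right-mid (¬e ∘ R-sym _ _)
  go mid     (low v) e ¬e = without-mid-low v e ¬e
  go (low u) left    e ¬e = without-left-low u e (¬e ∘ R-sym _ _)
  go (low u) right   e ¬e = without-right-low u e (¬e ∘ R-sym _ _)
  go (low u) mid     e ¬e = without-mid-low u e (¬e ∘ R-sym _ _)
  go (low u) (low v) e ¬e = without-low-low u v e ¬e

-- Criticality of the chains.

has-neighbour : ∀ k v → ∃[ u ] Gadget (suc k) v u
has-neighbour k       left          = mid , tt
has-neighbour k       right         = mid , tt
has-neighbour k       mid           = left , tt
has-neighbour zero    (low zero)    = left , tt
has-neighbour (suc k) (low v)       = let u , e = has-neighbour k v in low u , e

-- There are no isolated vertices, so a subgraph with every edge has every vertex as well. `Proper`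
-- is a bare negation; the witness comes from searching the finite vertex set twice.
missing-edge : ∀ k (H : Subgraph (chain k)) → Proper H →
               ∃[ u ] ∃[ v ] (Adj (chain k) u v × ¬ Subgraph.Edge H u v)
missing-edge k H proper = u , v , decidable-stable (T? _) (λ ¬e → ¬kept (⊥-elim ∘ ¬e)) ,
  λ e → ¬kept (λ _ → e)
  where
  open Subgraph H using (Edge; Vertex; edge; endpoint)

  kept? : ∀ u v → Dec (Adj (chain k) u v → Edge u v)
  kept? u v = T? (chainAdj k u v) →-dec T? (edge u v)

  spanning : (∀ u v → Adj (chain k) u v → Edge u v) → ∀ v → Vertex v
  spanning all v = let u , e = has-neighbour k v in endpoint (all v u (fromChainEdge k v u (inner e)))

  row : ∃[ u ] ¬ (∀ v → Adj (chain k) u v → Edge u v)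
  row = ¬∀⟶∃¬ _ _ (λ u → all? (kept? u)) (λ all → proper (spanning all , all))
  u = proj₁ row

  entry : ∃[ v ] ¬ (Adj (chain k) u v → Edge u v)
  entry = ¬∀⟶∃¬ _ _ (kept? u) (proj₂ row)
  v     = proj₁ entry
  ¬kept = proj₂ entry

-- At most three colours embed into `Fin 3`, where `ends-agree` contradicts the closing edge.
chain-not-3-colourable : ∀ k j → Colorable (chain k) j → 4 ≤ j
chain-not-3-colourable k j (c , proper) = ≰⇒> λ j≤3 →
  proper left right tt
    (inject≤-injective j≤3 j≤3 _ _
      (ends-agree (suc k) (λ v → inject≤ (c v) j≤3)
        (λ u v e eq → proper u v (fromChainEdge k u v (inner e)) (inject≤-injective j≤3 j≤3 _ _ eq))))

chain-4-colourable : ∀ k → Colorable (chain k) 4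
chain-4-colourable k = c⁺ , λ u v e → proper⁺ (chainEdge k u v e)
  where
  c : Fin (size (suc k)) → Fin 3
  c = proj₁ (gadget-colouring (suc k) zero)

  c⁺ : Fin (size (suc k)) → Fin 4
  -- Vertex `zero` is `left`; giving this one end a fresh fourth colour repairs the closing edge.
  c⁺ zero    = fromℕ 3
  c⁺ (suc v) = inject₁ (c (suc v))

  proper⁺ : ∀ {u v} → ChainEdge k u v → c⁺ u ≢ c⁺ v
  proper⁺ (inner {zero}  {suc v} e) = fromℕ≢inject₁
  proper⁺ (inner {suc u} {zero}  e) = fromℕ≢inject₁ ∘ sym
  proper⁺ (inner {suc u} {suc v} e) =
    proj₁ (proj₂ (gadget-colouring (suc k) zero)) (suc u) (suc v) e ∘ inject₁-injective
  proper⁺ closing  = fromℕ≢inject₁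
  proper⁺ closing˘ = fromℕ≢inject₁ ∘ sym

chain-critical : ∀ k → Critical 4 (chain k)
chain-critical k = (chain-4-colourable k , chain-not-3-colourable k) , subgraph-colouring
  where
  subgraph-colouring : ∀ (H : Subgraph (chain k)) → Proper H → Colorable (toGraph H) 3
  subgraph-colouring H H-proper with missing-edge k H H-proper
  ... | u₀ , v₀ , e₀ , ¬e₀ = by-edge (chainEdge k u₀ v₀ e₀) ¬e₀
    where
    open Subgraph H using (Edge; edge-symmetric; edge⊆)

    -- The closing edge is left out because `separate` handles only subrelations of the gadget.
    Kept : Fin (size (suc k)) → Fin (size (suc k)) → Set
    Kept u v = Edge u v × Gadget (suc k) u v

    Kept-sym : ∀ u v → Kept u v → Kept v u
    Kept-sym u v (e , g) = edge-symmetric e , Gadget-sym (suc k) u v g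

    restrict : (c : Fin (size (suc k)) → Fin 3) → ProperFor Kept c →
               (Edge left right → c left ≢ c right) → Colorable (toGraph H) 3
    restrict c proper ends =
      (c ∘ proj₁) , λ u v e → edge-ok e (chainEdge k (proj₁ u) (proj₁ v) (edge⊆ e))
      where
      edge-ok : ∀ {u v} → Edge u v → ChainEdge k u v → c u ≢ c v
      edge-ok e (inner g) = proper _ _ (e , g)
      edge-ok e closing   = ends e
      edge-ok e closing˘  = ends (edge-symmetric e) ∘ sym

    without-closing : ¬ Edge left right → Colorable (toGraph H) 3
    without-closing ¬e = let c , proper , _ = gadget-colouring (suc k) zero in
      restrict c (λ u v (_ , g) → proper u v g) (⊥-elim ∘ ¬e)

    by-edge : ∀ {u v} → ChainEdge k u v → ¬ Edge u v → Colorable (toGraph H) 3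
    by-edge {u} {v} (inner g) ¬e =
      let c , proper , l≢r = separate (suc k) Kept Kept-sym (λ _ _ → proj₂) u v g (¬e ∘ proj₁) in
      restrict c proper (λ _ → l≢r)
    by-edge closing  ¬e = without-closing ¬e
    by-edge closing˘ ¬e = without-closing (¬e ∘ edge-symmetric)

-- Cycle lengths

-- Only `p 0` to `p m` matter. Indexing by all of `ℕ` makes dropping the first or last vertex free
-- of `Fin` arithmetic.
record Path {V : Set} (R : V → V → Set) (m : ℕ) (p : ℕ → V) : Set where
  field
    step : ∀ i → i < m → R (p i) (p (suc i))
    inj  : ∀ i j → i < j → j ≤ m → p i ≢ p j

tail : ∀ {V R m} {p : ℕ → V} → Path R (suc m) p → Path R m (p ∘ suc)
tail P = record
  { step = λ i i<m → Path.step P (suc i) (s≤s i<m)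
  ; inj  = λ i j i<j j≤m → Path.inj P (suc i) (suc j) (s≤s i<j) (s≤s j≤m) }

init : ∀ {V R m} {p : ℕ → V} → Path R (suc m) p → Path R m p
init P = record
  { step = λ i i<m → Path.step P i (m≤n⇒m≤1+n i<m)
  ; inj  = λ i j i<j j≤m → Path.inj P i j i<j (m≤n⇒m≤1+n j≤m) }

-- A cycle of length ℓ traversed forever, so that choosing its starting point is a shift.
record Loop {V : Set} (R : V → V → Set) (ℓ : ℕ) (p : ℕ → V) : Set where
  field
    step   : ∀ i → R (p i) (p (suc i))
    period : ∀ i → p (i + ℓ) ≡ p i
    inj    : ∀ i j → i < j → j < i + ℓ → p i ≢ p j

module _ {V : Set} {R : V → V → Set} {ℓ : ℕ} {p : ℕ → V} (L : Loop R ℓ p) where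

  -- With the index `i + t`, position 0 of the new loop computes to `p t`.
  shift : ∀ t → Loop R ℓ (λ i → p (i + t))
  shift t = record
    { step   = λ i → Loop.step L (i + t)
    ; period = λ i → trans (cong p (swap i)) (Loop.period L (i + t))
    ; inj    = λ i j i<j j<i+ℓ → Loop.inj L (i + t) (j + t) (+-monoˡ-< t i<j)
                 (subst (j + t <_) (swap i) (+-monoˡ-< t j<i+ℓ)) }
    where
    swap : ∀ i → (i + ℓ) + t ≡ (i + t) + ℓ
    swap i = trans (+-assoc i ℓ t) (trans (cong (i +_) (+-comm ℓ t)) (sym (+-assoc i t ℓ)))

  periods : ∀ i q → p (i + q * ℓ) ≡ p i
  periods i zero    = cong p (+-identityʳ i)
  periods i (suc q) = trans
    (cong p (trans (cong (i +_) (+-comm ℓ (q * ℓ))) (sym (+-assoc i (q * ℓ) ℓ))))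
    (trans (Loop.period L (i + q * ℓ)) (periods i q))

  reduce : .{{_ : NonZero ℓ}} → ∀ i → p i ≡ p (i % ℓ)
  reduce i = trans (cong p (m≡m%n+[m/n]*n i ℓ)) (periods (i % ℓ) (i / ℓ))

  -- The successor is taken after the reduction, so an edge is carried to its copy in the first
  -- period even where the index wraps around.
  reduce-suc : .{{_ : NonZero ℓ}} → ∀ i → p (suc i) ≡ p (suc (i % ℓ))
  reduce-suc i = trans (cong (p ∘ suc) (m≡m%n+[m/n]*n i ℓ)) (periods (suc (i % ℓ)) (i / ℓ))

  -- Unlike `shift` by 1, this has `suc i` as its index, which is the form `cut` and `p ∘ suc` need.
  rotate : Loop R ℓ (p ∘ suc)
  rotate = record
    { step   = λ i → Loop.step L (suc i)
    ; period = λ i → Loop.period L (suc i)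
    ; inj    = λ i j i<j j<i+ℓ → Loop.inj L (suc i) (suc j) (s≤s i<j) (s≤s j<i+ℓ) }

cut : ∀ {V R ℓ} {p : ℕ → V} → Loop R (suc ℓ) p → Path R ℓ p
cut L = record
  { step = λ i _ → Loop.step L i
  ; inj  = λ i j i<j j≤ℓ → Loop.inj L i j i<j (≤-trans (s≤s j≤ℓ) (m≤n+m _ i)) }

fromCycle : ∀ {V} {G : Graph V} {ℓ} → Cycle G ℓ → ∃[ p ] Loop (Adj G) ℓ p
fromCycle {G = G} {suc n} C = (λ i → at (i mod ℓ)) , record
  { step   = step′
  ; period = λ i → cong at (toℕ-injective (trans (toℕ-mod (i + ℓ))
      (trans ([m+n]%n≡m%n i ℓ) (sym (toℕ-mod i)))))
  ; inj    = λ i j i<j j<i+ℓ eq → inj′ i j i<j j<i+ℓ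
      (trans (sym (toℕ-mod i)) (trans (cong toℕ (injective eq)) (toℕ-mod j))) }
  where
  open Cycle C
  ℓ = suc n

  toℕ-mod : ∀ i → toℕ (i mod ℓ) ≡ i % ℓ
  toℕ-mod i = toℕ-fromℕ< (m%n<n i ℓ)

  suc-% : ∀ i → suc i % ℓ ≡ suc (i % ℓ) % ℓ
  suc-% i = trans (cong (λ x → suc x % ℓ) (m≡m%n+[m/n]*n i ℓ)) ([m+kn]%n≡m%n (suc (i % ℓ)) (i / ℓ) ℓ)

  step′ : ∀ i → Adj G (at (i mod ℓ)) (at (suc i mod ℓ))
  step′ i with m≤n⇒m<n∨m≡n (m%n<n i ℓ)
  ... | inj₁ lt = step _ _
    (trans (toℕ-mod (suc i)) (trans (suc-% i) (trans (m<n⇒m%n≡m lt) (cong suc (sym (toℕ-mod i))))))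
  ... | inj₂ eq = close _ _ (trans (cong suc (toℕ-mod i)) eq)
    (trans (toℕ-mod (suc i)) (trans (suc-% i) (trans (cong (_% ℓ) eq) (n%n≡0 ℓ))))

  -- With equal remainders, `i < j < i + ℓ` would put the quotient of `j` strictly between two
  -- consecutive numbers.
  inj′ : ∀ i j → i < j → j < i + ℓ → i % ℓ ≢ j % ℓ
  inj′ i j i<j j<i+ℓ eq = <⇒≱ q<q′ (m<1+n⇒m≤n q′<1+q)
    where
    r = i % ℓ
    i≡ : i ≡ r + (i / ℓ) * ℓ
    i≡ = m≡m%n+[m/n]*n i ℓ
    j≡ : j ≡ r + (j / ℓ) * ℓ
    j≡ = trans (m≡m%n+[m/n]*n j ℓ) (cong (_+ (j / ℓ) * ℓ) (sym eq))
    q<q′ : i / ℓ < j / ℓ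
    q<q′ = *-cancelʳ-< ℓ (i / ℓ) (j / ℓ) (+-cancelˡ-< r _ _ (subst₂ _<_ i≡ j≡ i<j))
    q′<1+q : j / ℓ < suc (i / ℓ)
    q′<1+q = *-cancelʳ-< ℓ (j / ℓ) (suc (i / ℓ)) (+-cancelˡ-< r _ _ (subst₂ _<_ j≡
      (trans (cong (_+ ℓ) i≡) (trans (+-assoc r _ ℓ) (cong (r +_) (+-comm _ ℓ)))) j<i+ℓ))

-- Neighbourhoods in a gadget and descent to the smaller one.

end-neighbour : ∀ k s v → Gadget (suc k) (end (suc k) s) v → v ≡ mid ⊎ v ≡ low (end k true)
end-neighbour k true  mid     e = inj₁ refl
end-neighbour k true  (low v) e = inj₂ (cong (λ v → low v) (isEnd⇒≡ k true e))
end-neighbour k false mid     e = inj₁ refl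
end-neighbour k false (low v) e = inj₂ (cong (λ v → low v) (isEnd⇒≡ k true e))

mid-neighbour : ∀ k v → Gadget (suc k) mid v → (∃[ s ] v ≡ end (suc k) s) ⊎ v ≡ low (end k false)
mid-neighbour k left    e = inj₁ (true , refl)
mid-neighbour k right   e = inj₁ (false , refl)
mid-neighbour k (low v) e = inj₂ (cong (λ v → low v) (isEnd⇒≡ k false e))

end≢mid : ∀ k s → end (suc k) s ≢ mid
end≢mid k true  ()
end≢mid k false ()

end≢low : ∀ k s v → end (suc k) s ≢ low v
end≢low k true  v ()
end≢low k false v ()

ends-distinct : ∀ k s → end (suc k) s ≢ end (suc k) (not s)
ends-distinct k true  ()
ends-distinct k false ()

avoids-ends : ∀ k s {v} → v ≢ end (suc k) s → v ≢ end (suc k) (not s) → ∀ t → v ≢ end (suc k) t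
avoids-ends k true  a b true  = a
avoids-ends k true  a b false = b
avoids-ends k false a b true  = b
avoids-ends k false a b false = a

-- Left inverse of low; the other three values are junk.
lower : ∀ k → Fin (size (suc k)) → Fin (size k)
lower k left    = end k true
lower k right   = end k true
lower k mid     = end k true
lower k (low v) = v

Lower : ∀ k → Fin (size (suc k)) → Set
Lower k v = (∀ s → v ≢ end (suc k) s) × v ≢ mid

lower-inverse : ∀ k (v : Fin (size (suc k))) → Lower k v → v ≡ low (lower k v)
lower-inverse k left    (¬end , ¬mid) = ⊥-elim (¬end true refl)
lower-inverse k right   (¬end , ¬mid) = ⊥-elim (¬end false refl)
lower-inverse k mid     (¬end , ¬mid) = ⊥-elim (¬mid refl)
lower-inverse k (low v) _             = refl

lower-injective : ∀ {k} {u v : Fin (size (suc k))} → Lower k u → Lower k v →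
                  lower k u ≡ lower k v → u ≡ v
lower-injective {k} {u} {v} lu lv eq =
  trans (lower-inverse k u lu) (trans (cong (λ v → low v) eq) (sym (lower-inverse k v lv)))

lower-edge : ∀ {k} {u v : Fin (size (suc k))} → Lower k u → Lower k v →
             Gadget (suc k) u v → Gadget k (lower k u) (lower k v)
lower-edge {k} {u} {v} lu lv = subst₂ (Gadget (suc k)) (lower-inverse k u lu) (lower-inverse k v lv)

lower-path : ∀ {k m} {p : ℕ → Fin (size (suc k))} →
             Path (Gadget (suc k)) m p → (∀ i → i ≤ m → Lower k (p i)) →
             Path (Gadget k) m (lower k ∘ p)
lower-path {k} {p = p} P lows = record
  { step = λ i i<m → lower-edge {k} {p i} {p (suc i)} (lows i (<⇒≤ i<m)) (lows (suc i) i<m)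
               (Path.step P i i<m)
  ; inj  = λ i j i<j j≤m →
      Path.inj P i j i<j j≤m ∘
        lower-injective {k} {p i} {p j} (lows i (≤-trans (<⇒≤ i<j) j≤m)) (lows j j≤m) }

lower-loop : ∀ {k ℓ} {p : ℕ → Fin (size (suc k))} →
             Loop (Gadget (suc k)) ℓ p → (∀ i → Lower k (p i)) →
             Loop (Gadget k) ℓ (lower k ∘ p)
lower-loop {k} {p = p} L lows = record
  { step   = λ i → lower-edge {k} {p i} {p (suc i)} (lows i) (lows (suc i)) (Loop.step L i)
  ; period = λ i → cong (lower k) (Loop.period L i)
  ; inj    = λ i j i<j j<i+ℓ →
      Loop.inj L i j i<j j<i+ℓ ∘ lower-injective {k} {p i} {p j} (lows i) (lows j) }

-- Lengths of paths between the ends.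

PathLength : ℕ → ℕ → Set
PathLength k m = m ≡ k * 3 ⊎ ∃[ q ] m ≡ 2 + q * 3

-- Both ends have just the neighbours `mid` and `low (end k true)`. If the path leaves and arrives
-- through the same one, its length is 2. Otherwise it uses both, and beyond `mid` it can only go on
-- to `low (end k false)`, so the rest joins the inner ends. The sign `s` is the direction, which
-- the recursion may reverse.
path-length : ∀ k s {m p} → Path (Gadget k) m p →
              p 0 ≡ end k s → p m ≡ end k (not s) → PathLength k m
path-length zero s {zero}  P p₀ pₘ = inj₁ refl
path-length zero s {suc m} P p₀ pₘ = ⊥-elim (Path.step P 0 (s≤s z≤n))
path-length (suc k) s {zero} P p₀ pₘ = ⊥-elim (ends-distinct k s (trans (sym p₀) pₘ))
path-length (suc k) s {suc zero} P p₀ pₘ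
  with end-neighbour k s _ (subst₂ (Gadget (suc k)) p₀ pₘ (Path.step P 0 (s≤s z≤n)))
... | inj₁ eq = ⊥-elim (end≢mid k (not s) eq)
... | inj₂ eq = ⊥-elim (end≢low k (not s) _ eq)
path-length (suc k) s {suc (suc n)} {p} P p₀ pₘ = go n P pₘ
    (end-neighbour k s _ (subst (λ v → Gadget (suc k) v (p 1)) p₀ (Path.step P 0 (s≤s z≤n))))
    (end-neighbour k (not s) _ (subst (λ v → Gadget (suc k) v (p (suc n))) pₘ
      (Gadget-sym (suc k) (p (suc n)) (p (2 + n)) (Path.step P (suc n) ≤-refl))))
  where
  not-end : ∀ n → Path (Gadget (suc k)) (2 + n) p → p (2 + n) ≡ end (suc k) (not s) →
            ∀ i → i ≤ n → ∀ t → p (suc i) ≢ end (suc k) t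
  not-end n P pₘ i i≤n = avoids-ends k s
    (λ eq → Path.inj P 0 (suc i) (s≤s z≤n) (s≤s (m≤n⇒m≤1+n i≤n)) (trans p₀ (sym eq)))
    (λ eq → Path.inj P (suc i) (2 + n) (s≤s (s≤s i≤n)) ≤-refl (trans eq (sym pₘ)))

  three-more : ∀ {m} → PathLength k m → PathLength (suc k) (3 + m)
  three-more (inj₁ refl)       = inj₁ refl
  three-more (inj₂ (q , refl)) = inj₂ (suc q , refl)

  straight : ∀ n → Path (Gadget (suc k)) (2 + n) p → p 1 ≡ p (suc n) → PathLength (suc k) (2 + n)
  straight zero    P eq = inj₂ (0 , refl)
  straight (suc n) P eq = ⊥-elim (Path.inj P 1 (2 + n) (s≤s (s≤s z≤n)) (n≤1+n _) eq)

  go : ∀ n → Path (Gadget (suc k)) (2 + n) p → p (2 + n) ≡ end (suc k) (not s) →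
       p 1 ≡ mid ⊎ p 1 ≡ low (end k true) →
       p (suc n) ≡ mid ⊎ p (suc n) ≡ low (end k true) → PathLength (suc k) (2 + n)
  go n       P pₘ (inj₁ a) (inj₁ b) = straight n P (trans a (sym b))
  go n       P pₘ (inj₂ a) (inj₂ b) = straight n P (trans a (sym b))
  go zero    P pₘ (inj₁ a) (inj₂ b) with () ← trans (sym a) b
  go zero    P pₘ (inj₂ a) (inj₁ b) with () ← trans (sym a) b
  go (suc n) P pₘ (inj₁ a) (inj₂ b)
    with mid-neighbour k _ (subst (λ v → Gadget (suc k) v (p 2)) a (Path.step P 1 (s≤s (s≤s z≤n))))
  ... | inj₁ (t , eq) = ⊥-elim (not-end (suc n) P pₘ 1 (s≤s z≤n) t eq)
  -- Without its first two vertices and its last one, the path runs from the second inner end to the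
  -- first.
  ... | inj₂ eq = three-more (path-length k false
    (lower-path {k} (init (tail (tail P))) λ i i≤n →
      not-end (suc n) P pₘ (suc i) (s≤s i≤n) ,
      λ eq′ → Path.inj P 1 (2 + i) (s≤s (s≤s z≤n)) (s≤s (s≤s (m≤n⇒m≤1+n i≤n))) (trans a (sym eq′)))
    (cong (lower k) eq) (cong (lower k) b))
  go (suc n) P pₘ (inj₂ a) (inj₁ b)
    with mid-neighbour k _ (subst (λ v → Gadget (suc k) v (p (suc n))) b
           (Gadget-sym (suc k) (p (suc n)) (p (2 + n)) (Path.step P (suc n) (n≤1+n _))))
  ... | inj₁ (t , eq) = ⊥-elim (not-end (suc n) P pₘ n (n≤1+n n) t eq)
  ... | inj₂ eq = three-more (path-length k true
    (lower-path {k} (init (init (tail P))) λ i i≤n →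
      not-end (suc n) P pₘ i (m≤n⇒m≤1+n i≤n) ,
      λ eq′ → Path.inj P (suc i) (2 + n) (s≤s (s≤s i≤n)) (n≤1+n _) (trans eq′ (sym b)))
    (cong (lower k) a) (cong (lower k) eq))

-- Cycle lengths of a gadget.

LoopLength : ℕ → Set
LoopLength ℓ = ℓ ≡ 4 ⊎ ∃[ q ] (ℓ ≡ q * 3 ⊎ ℓ ≡ 2 + q * 3)

path⇒loop-length : ∀ k {m} → PathLength k m → LoopLength (3 + m)
path⇒loop-length k (inj₁ refl)       = inj₂ (suc k , inj₁ refl)
path⇒loop-length k (inj₂ (q , refl)) = inj₂ (suc q , inj₂ refl)

-- Split on the two neighbours of `mid` along the loop. Two ends give a 4-cycle; an end and
-- `low (end k false)` leave a path joining the inner ends, three edges shorter; they cannot both be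
-- `low (end k false)`.
loop-at-mid : ∀ k {m p} → Loop (Gadget (suc k)) (3 + m) p → p 0 ≡ mid → LoopLength (3 + m)
loop-at-mid k {m} {p} L p₀ = go
    (mid-neighbour k _ (subst (λ v → Gadget (suc k) v (p 1)) p₀ (Loop.step L 0)))
    (mid-neighbour k _ (subst (λ v → Gadget (suc k) v (p (2 + m))) pₗ
      (Gadget-sym (suc k) (p (2 + m)) (p (3 + m)) (Loop.step L (2 + m)))))
  where
  P : Path (Gadget (suc k)) (2 + m) p
  P = cut L

  pₗ : p (3 + m) ≡ mid
  pₗ = trans (Loop.period L 0) p₀

  ¬mid : ∀ i → i < 2 + m → p (suc i) ≢ mid
  ¬mid i i<m eq = Path.inj P 0 (suc i) (s≤s z≤n) i<m (trans p₀ (sym eq))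

  after-end : ∀ s i → i < 2 + m → p i ≡ end (suc k) s → p (suc i) ≡ low (end k true)
  after-end s i i<m eq
    with end-neighbour k s _ (subst (λ v → Gadget (suc k) v (p (suc i))) eq (Loop.step L i))
  ... | inj₁ eq′ = ⊥-elim (¬mid i i<m eq′)
  ... | inj₂ eq′ = eq′

  before-end : ∀ s i → i < 2 + m → p (2 + i) ≡ end (suc k) s → p (suc i) ≡ low (end k true)
  before-end s i i<m eq
    with end-neighbour k s _ (subst (λ v → Gadget (suc k) v (p (suc i))) eq
           (Gadget-sym (suc k) (p (suc i)) (p (2 + i)) (Loop.step L (suc i))))
  ... | inj₁ eq′ = ⊥-elim (¬mid i i<m eq′)
  ... | inj₂ eq′ = eq′

  go : (∃[ s ] p 1 ≡ end (suc k) s) ⊎ p 1 ≡ low (end k false) →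
       (∃[ s ] p (2 + m) ≡ end (suc k) s) ⊎ p (2 + m) ≡ low (end k false) → LoopLength (3 + m)
  go (inj₁ (s , a)) (inj₁ (t , b)) = four m refl
    where
    -- The vertex `low (end k true)` follows the first end and precedes the last, and may occur only
    -- once, which leaves `m` equal to 1.
    four : ∀ n → m ≡ n → LoopLength (3 + m)
    four zero refl with () ← end≢low k t _ (trans (sym b) (after-end s 1 (s≤s (s≤s z≤n)) a))
    four (suc zero) eq = inj₁ (cong (3 +_) eq)
    four (suc (suc n)) refl = ⊥-elim (Path.inj P 2 (3 + n) (s≤s (s≤s (s≤s z≤n))) (n≤1+n _)
      (trans (after-end s 1 (s≤s (s≤s z≤n)) a) (sym (before-end t (2 + n) (n≤1+n _) b))))
  go (inj₁ (s , a)) (inj₂ b) = path⇒loop-length k (path-length k true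
    (lower-path {k} (tail (tail P)) λ i i≤m →
      avoids-ends k s
        (λ eq → Path.inj P 1 (2 + i) (s≤s (s≤s z≤n)) (s≤s (s≤s i≤m)) (trans a (sym eq)))
        (not-other i (m≤n⇒m<n∨m≡n i≤m)) ,
      ¬mid (1 + i) (s≤s (s≤s i≤m)))
    (cong (lower k) p₂) (cong (lower k) b))
    where
    p₂ : p 2 ≡ low (end k true)
    p₂ = after-end s 1 (s≤s (s≤s z≤n)) a

    -- The other end would lead on to `low (end k true)` a second time, except at the last position,
    -- which is not an end.
    not-other : ∀ i → i < m ⊎ i ≡ m → p (2 + i) ≢ end (suc k) (not s)
    not-other i (inj₁ i<m)  eq = Path.inj P 2 (3 + i) (s≤s (s≤s (s≤s z≤n))) (s≤s (s≤s i<m))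
      (trans p₂ (sym (after-end (not s) (2 + i) (s≤s (s≤s i<m)) eq)))
    not-other i (inj₂ refl) eq = end≢low k (not s) _ (trans (sym eq) b)
  go (inj₂ a) (inj₁ (s , b)) = path⇒loop-length k (path-length k false
    (lower-path {k} (init (tail P)) λ i i≤m →
      avoids-ends k s
        (λ eq → Path.inj P (1 + i) (2 + m) (s≤s (s≤s i≤m)) ≤-refl (trans eq (sym b)))
        (not-other i i≤m) ,
      ¬mid i (m≤n⇒m≤1+n (s≤s i≤m)))
    (cong (lower k) a) (cong (lower k) p₁₊ₘ))
    where
    p₁₊ₘ : p (1 + m) ≡ low (end k true)
    p₁₊ₘ = before-end s m (n≤1+n _) b

    not-other : ∀ i → i ≤ m → p (1 + i) ≢ end (suc k) (not s)
    not-other zero    _   eq = end≢low k (not s) _ (trans (sym eq) a)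
    not-other (suc i) i<m eq = Path.inj P (1 + i) (1 + m) (s≤s i<m) (n≤1+n _)
      (trans (before-end (not s) i (m≤n⇒m≤1+n (m≤n⇒m≤1+n i<m)) eq) (sym p₁₊ₘ))
  go (inj₂ a) (inj₂ b) = ⊥-elim (Path.inj P 1 (2 + m) (s≤s (s≤s z≤n)) ≤-refl (trans a (sym b)))

-- A loop avoiding `mid` also avoids both ends, each of which then has a single neighbour left, and
-- so it lies in the smaller gadget.
loop-length : ∀ k {m p} → Loop (Gadget k) (3 + m) p → LoopLength (3 + m)
loop-length zero L = ⊥-elim (Loop.step L 0)
loop-length (suc k) {m} {p} L with anyUpTo? (λ i → p i ≟ mid) (3 + m)
... | yes (t , _ , pₜ) = loop-at-mid k (shift L t) pₜ
... | no ¬∃mid = loop-length k (lower-loop {k} L λ i → not-end i , not-mid i)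
  where
  not-mid : ∀ i → p i ≢ mid
  not-mid i eq = ¬∃mid (i % (3 + m) , m%n<n i (3 + m) , trans (sym (reduce L i)) eq)

  to-low : ∀ i s {v} → v ≡ end (suc k) s → Gadget (suc k) v (p i) → p i ≡ low (end k true)
  to-low i s refl e with end-neighbour k s (p i) e
  ... | inj₁ eq = ⊥-elim (not-mid i eq)
  ... | inj₂ eq = eq

  not-end : ∀ t s → p t ≢ end (suc k) s
  not-end t s pₜ = Loop.inj (shift L t) 1 (2 + m) (s≤s (s≤s z≤n)) (n≤1+n _) (trans
    (to-low (1 + t) s pₜ (Loop.step L t))
    (sym (to-low (2 + m + t) s (trans (Loop.period (shift L t) 0) pₜ)
      (Gadget-sym (suc k) (p (2 + m + t)) (p (3 + m + t)) (Loop.step L (2 + m + t))))))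

-- Cycle lengths of a chain.

ChainLoopLength : ℕ → ℕ → Set
ChainLoopLength k ℓ = LoopLength ℓ ⊎ ℓ ≡ 1 + suc k * 3

inner-or-closing : ∀ k {u v} → ChainEdge k u v →
  Gadget (suc k) u v ⊎ (∃[ s ] (u ≡ end (suc k) s × v ≡ end (suc k) (not s)))
inner-or-closing k (inner e) = inj₁ e
inner-or-closing k closing   = inj₂ (true , refl , refl)
inner-or-closing k closing˘  = inj₂ (false , refl , refl)

-- Removing the closing edge leaves a path of the gadget between its ends; no further closing edge
-- occurs, as no interior vertex of that path is an end.
closing-loop-length : ∀ k s {m p} → Loop (Adj (chain k)) (3 + m) p →
  p 0 ≡ end (suc k) s → p 1 ≡ end (suc k) (not s) → ChainLoopLength k (3 + m)
closing-loop-length k s {m} {p} L p₀ p₁ =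
  conclude (path-length (suc k) (not s) inner-path p₁
    (trans (Loop.period L 0) (trans p₀ (cong (end (suc k)) (sym (not-involutive s))))))
  where
  not-end : ∀ i → i < 1 + m → ∀ t → p (2 + i) ≢ end (suc k) t
  not-end i i<m = avoids-ends k s
    (λ eq → Loop.inj L 0 (2 + i) (s≤s z≤n) (s≤s (s≤s i<m)) (trans p₀ (sym eq)))
    (λ eq → Loop.inj L 1 (2 + i) (s≤s (s≤s z≤n)) (m≤n⇒m≤1+n (s≤s (s≤s i<m))) (trans p₁ (sym eq)))

  inner-step : ∀ i → i < 2 + m → ChainEdge k (p (1 + i)) (p (2 + i)) →
               Gadget (suc k) (p (1 + i)) (p (2 + i))
  inner-step i       i<m e with inner-or-closing k e
  inner-step i       i<m e | inj₁ g                = g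
  inner-step zero    i<m e | inj₂ (t , _ , eq)     = ⊥-elim (not-end 0 (s≤s z≤n) (not t) eq)
  inner-step (suc i) i<m e | inj₂ (t , eq , _)     = ⊥-elim (not-end i (m<1+n⇒m≤n i<m) t eq)

  inner-path : Path (Gadget (suc k)) (2 + m) (p ∘ suc)
  inner-path = record
    { step = λ i i<m → inner-step i i<m (chainEdge k _ _ (Path.step (cut (rotate L)) i i<m))
    ; inj  = Path.inj (cut (rotate L)) }

  conclude : PathLength (suc k) (2 + m) → ChainLoopLength k (3 + m)
  conclude (inj₁ eq)       = inj₂ (cong suc eq)
  conclude (inj₂ (q , eq)) = inj₁ (inj₂ (suc q , inj₁ (cong suc eq)))

chain-loop-length : ∀ k {m p} → Loop (Adj (chain k)) (3 + m) p → ChainLoopLength k (3 + m)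
chain-loop-length k {m} {p} L
  with anyUpTo? (λ i → ¬? (T? (gadgetAdj (suc k) (p i) (p (suc i))))) (3 + m)
... | no ¬∃closing = inj₁ (loop-length (suc k) (record
  -- The search covered one period only; reduction modulo the length extends its outcome to every
  -- index.
  { step   = λ i → subst₂ (Gadget (suc k)) (sym (reduce L i)) (sym (reduce-suc L i))
      (decidable-stable (T? _) (λ ¬g → ¬∃closing (i % (3 + m) , m%n<n i (3 + m) , ¬g)))
  ; period = Loop.period L
  ; inj    = Loop.inj L }))
... | yes (t , _ , ¬g) with inner-or-closing k (chainEdge k _ _ (Loop.step L t))
...   | inj₁ g             = ⊥-elim (¬g g)
...   | inj₂ (s , p₀ , p₁) = closing-loop-length k s (shift L t) p₀ p₁

chain-cycle-length : ∀ k {ℓ} → Cycle (chain k) ℓ → ChainLoopLength k ℓ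
chain-cycle-length k C with Cycle.3≤ℓ C | fromCycle C
... | s≤s (s≤s (s≤s z≤n)) | p , L = chain-loop-length k L

-- Eleven consecutive lengths are impossible.

1+3a≢3b : ∀ a b → 1 + a * 3 ≢ b * 3
1+3a≢3b a b eq with () ←
  trans (sym ([m+kn]%n≡m%n 1 a 3)) (trans (cong (_% 3) eq) ([m+kn]%n≡m%n 0 b 3))

1+3a≢2+3b : ∀ a b → 1 + a * 3 ≢ 2 + b * 3
1+3a≢2+3b a b eq with () ←
  trans (sym ([m+kn]%n≡m%n 1 a 3)) (trans (cong (_% 3) eq) ([m+kn]%n≡m%n 2 b 3))

-- Writing the length with `2 + q` makes it at least 7, which rules out the exceptional length 4.
residue-one-cycle : ∀ k q → Cycle (chain k) (1 + (2 + q) * 3) → 2 + q ≡ suc k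
residue-one-cycle k q C with chain-cycle-length k C
... | inj₁ (inj₁ ())
... | inj₁ (inj₂ (r , inj₁ eq)) = ⊥-elim (1+3a≢3b (2 + q) r eq)
... | inj₁ (inj₂ (r , inj₂ eq)) = ⊥-elim (1+3a≢2+3b (2 + q) r eq)
... | inj₂ eq                   = *-cancelʳ-≡ _ _ 3 (suc-injective eq)

chain-not-11-consecutive : ∀ k {m} → 11 ≤ m → ¬ ContainsConsecutiveCycles (chain k) m
chain-not-11-consecutive k {m} 11≤m (a , cycles) =
  -- For `q = a / 3`, the lengths `7 + q * 3` and `10 + q * 3` both lie in the window, are 1 mod 3
  -- and exceed 4. The chain has only one such length.
  1+n≢n (trans (residue-one-cycle k (suc q) (cycle (9 + q * 3) above₂ ≤-refl))
               (sym (residue-one-cycle k q (cycle (6 + q * 3) above₁ (m≤n+m _ 3)))))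
  where
  q : ℕ
  q = a / 3

  cycle : ∀ d → a ≤ suc d → suc d < 11 + q * 3 → Cycle (chain k) (suc d)
  cycle d lo hi = cycles (suc d) lo (≤-trans hi
    (≤-trans (+-mono-≤ 11≤m (m/n*n≤m a 3)) (≤-reflexive (+-comm m a))))

  above₁ : a ≤ 7 + q * 3
  above₁ = ≤-trans (≤-reflexive (m≡m%n+[m/n]*n a 3))
    (+-monoˡ-≤ (q * 3) (≤-trans (<⇒≤ (m%n<n a 3)) (m≤m+n 3 4)))

  above₂ : a ≤ 10 + q * 3
  above₂ = ≤-trans above₁ (m≤n+m _ 3)

k≤size : ∀ k → k ≤ size k
k≤size zero    = z≤n
k≤size (suc k) = s≤s (≤-trans (k≤size k) (m≤n+m _ 2))

theorem1p2 : ¬ (Σ[ f₃ ∈ (ℕ → ℕ) ]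
    (TendsToInfinity f₃ ×
    (∀ (n : ℕ) (G : Graph (Fin n)) → Critical 4 G →
    ContainsConsecutiveCycles G (f₃ n))))
theorem1p2 (f₃ , f₃→∞ , cycles) =
  -- The chain with index `N` has more than `N` vertices, so its order is past the threshold beyond
  -- which `f₃` is at least 11.
  let N , 11≤f₃ = f₃→∞ 11
      n         = size (suc N)
  in chain-not-11-consecutive N
       (11≤f₃ n (≤-trans (n≤1+n N) (k≤size (suc N))))
       (cycles n (chain N) (chain-critical N))
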